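{- Let $(x_n)_{n\ge 0}$ be the sequence of positive integers defined by $x_0=x_1=1$ and $x_{n+2}x_n=x_{n+1}^2(x_n+1)$ for $n\ge 0$. Then $$\left[0;1,1,1,x_1,x_2,x_3,x_4,x_5,\ldots,x_n,\ldots\right]=\sum_{n=1}^{\infty}\frac{(-1)^{n-1}}{x_n}.$$
   Context: $[c_0;c_1,c_2,\ldots]$ denotes the regular continued fraction $c_0+\cfrac{1}{c_1+\cfrac{1}{c_2+\cdots}}$. Here $c_0=0$, $c_1=c_2=c_3=1$, and $c_{k+3}=x_k$ for $k\ge 1$. -}

module Defs where

open import Data.Integer.Base as ℤ using (+_)
open import Data.Nat.Base as ℕ using (ℕ; zero; suc; NonZero; _≥_)
open import Data.Nat.Properties using (m*n≢0)
open import Data.Nat.Solver using (module +-*-Solver)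
open import Data.Product.Base using (∃; ∃-syntax; _×_; _,_; proj₁; proj₂)
open import Data.Rational.Base as ℚ
  using (ℚ; 0ℚ; Positive; _+_; _-_; _/_; 1/_; ∣_∣; _≤_)
open import Data.Rational.Properties
  using (pos+pos⇒pos; pos⇒nonZero; 1/pos⇒pos; normalize-pos)
open import Function.Base using (_∘_)
open import Relation.Binary.PropositionalEquality using (_≡_; refl)

-- Bishop's real numbers: regular sequences of rationals, the n-th term being
-- within 1/(n+1) of the number represented.
record ℝ : Set where
  field
    approx  : ℕ → ℚ
    regular : ∀ m n →
      ∣ approx m - approx n ∣ ≤ (+ 1 / suc m) + (+ 1 / suc n)

open ℝ public

-- ∣ q - α ∣ ≤ ε as real numbers: m ↦ ∣ q - approx α m ∣ is a regular sequence
-- representing ∣ q - α ∣, so the inequality of reals means that each of its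
-- terms exceeds ε by at most 1/(m+1).
∣_-_∣≤_ : ℚ → ℝ → ℚ → Set
∣ q - α ∣≤ ε = ∀ m → ∣ q - approx α m ∣ ≤ ε + (+ 1 / suc m)

infix 4 _⟶_

_⟶_ : (ℕ → ℚ) → ℝ → Set
q ⟶ α = ∀ ε → Positive ε → ∃[ N ] (∀ n → n ≥ N → ∣ q n - α ∣≤ ε)

-- convergent c _ n = [c₀; c₁, …, cₙ]; the positivity of c₁, c₂, … makes every
-- denominator that occurs nonzero.
convergent : (c : ℕ → ℕ) → (∀ k → NonZero (c (suc k))) → ℕ → ℚ
convergent-pos : (c : ℕ → ℕ) (c⁺ : ∀ k → NonZero (c (suc k))) →
                 NonZero (c 0) → ∀ n → Positive (convergent c c⁺ n)

convergent c c⁺ zero    = + c 0 / 1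
convergent c c⁺ (suc n) = (+ c 0 / 1) + (1/ tail) {{tail≢0}}
  where
  tail : ℚ
  tail = convergent (c ∘ suc) (c⁺ ∘ suc) n

  tail≢0 : ℚ.NonZero tail
  tail≢0 = pos⇒nonZero tail {{convergent-pos (c ∘ suc) (c⁺ ∘ suc) (c⁺ 0) n}}

convergent-pos c c⁺ c₀⁺ zero    = normalize-pos (c 0) 1 {{_}} {{c₀⁺}}
convergent-pos c c⁺ c₀⁺ (suc n) =
  pos+pos⇒pos (+ c 0 / 1) {{normalize-pos (c 0) 1 {{_}} {{c₀⁺}}}}
    (1/ tail) {{1/pos⇒pos tail}}
  where
  tail : ℚ
  tail = convergent (c ∘ suc) (c⁺ ∘ suc) n

  instance
    tail⁺ : Positive tail
    tail⁺ = convergent-pos (c ∘ suc) (c⁺ ∘ suc) (c⁺ 0) n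

    tail≢0 : ℚ.NonZero tail
    tail≢0 = pos⇒nonZero tail

-- α = [c₀; c₁, c₂, …]
IsContinuedFraction : (c : ℕ → ℕ) → (∀ k → NonZero (c (suc k))) → ℝ → Set
IsContinuedFraction c c⁺ α = convergent c c⁺ ⟶ α

-- f 1 + … + f N; the value f 0 is not used.
partialSum : (ℕ → ℚ) → ℕ → ℚ
partialSum f zero    = 0ℚ
partialSum f (suc N) = partialSum f N + f (suc N)

-- α = f 1 + f 2 + …
IsSeriesSum : (ℕ → ℚ) → ℝ → Set
IsSeriesSum f α = partialSum f ⟶ α

record IsSequence (x : ℕ → ℕ) : Set where
  field
    positive   : ∀ n → NonZero (x n)
    x₀≡1       : x 0 ≡ 1
    x₁≡1       : x 1 ≡ 1
    recurrence : ∀ n →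
      x (suc (suc n)) ℕ.* x n ≡ x (suc n) ℕ.^ 2 ℕ.* (x n ℕ.+ 1)

-- The recurrence does have a solution in positive integers: the ratios
-- yₙ = xₙ₊₁ / xₙ are integers, with y₀ = 1 and yₙ₊₁ = yₙ (xₙ + 1).
sequence-exists : ∃ IsSequence
sequence-exists = proj₁ ∘ xy , record
  { positive   = proj₁ ∘ xy⁺
  ; x₀≡1       = refl
  ; x₁≡1       = refl
  ; recurrence = λ n → identity (proj₁ (xy n)) (proj₂ (xy n))
  }
  where
  xy : ℕ → ℕ × ℕ
  xy zero    = 1 , 1
  xy (suc n) = let (x , y) = xy n in x ℕ.* y , y ℕ.* suc x

  xy⁺ : ∀ n → NonZero (proj₁ (xy n)) × NonZero (proj₂ (xy n))
  xy⁺ zero    = _ , _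
  xy⁺ (suc n) = let (x⁺ , y⁺) = xy⁺ n in
    m*n≢0 _ _ {{x⁺}} {{y⁺}} , m*n≢0 _ _ {{y⁺}}

  open +-*-Solver

  identity : ∀ x y →
    (x ℕ.* y) ℕ.* (y ℕ.* suc x) ℕ.* x ≡ (x ℕ.* y) ℕ.^ 2 ℕ.* (x ℕ.+ 1)
  identity = solve 2 (λ x y →
    (x :* y) :* (y :* (con 1 :+ x)) :* x := (x :* y) :^ 2 :* (x :+ con 1)) refl

-- 0, 1, 1, 1, x₁, x₂, x₃, …
quotients : (ℕ → ℕ) → ℕ → ℕ
quotients x 0 = 0
quotients x 1 = 1
quotients x 2 = 1
quotients x 3 = 1
quotients x (suc (suc (suc (suc k)))) = x (suc k)

quotients⁺ : ∀ {x} → IsSequence x → ∀ k → NonZero (quotients x (suc k))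
quotients⁺ s 0 = _
quotients⁺ s 1 = _
quotients⁺ s 2 = _
quotients⁺ s (suc (suc (suc k))) = IsSequence.positive s (suc k)

{-# OPTIONS --safe #-}

-- The ratios yₙ = xₙ₊₁ / xₙ are integers with y₀ = 1 and yₙ₊₁ = yₙ (xₙ + 1).
-- With Sₙ the partial sums of the series and pₙ / qₙ the convergents, the
-- recurrences of the continuants give
--   pₙ₊₃ = yₙ₊₁ Sₙ₊₁ + Sₙ   and   qₙ₊₃ = yₙ₊₁ + 1,
-- so that each convergent is a weighted mean of two consecutive partial sums.
-- Since yₙ₊₁ ≥ 2, the terms of the series at least halve in absolute value at
-- each step, so the Sₙ converge, and the convergents have the same limit.
module Submission where

open import Defs
open import Data.Integer.Base as ℤ using (+_; -1ℤ; _^_)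
import Data.Integer.Properties as ℤ
open import Data.Nat.Base as ℕ using (ℕ; zero; suc; NonZero; _∸_; s≤s; z≤n)
import Data.Nat.Properties as ℕ
import Data.Nat.Solver as ℕSolver
open import Data.Product.Base using (∃-syntax; _×_; _,_)
open import Data.Rational.Base as ℚ
  using (ℚ; mkℚ; 0ℚ; 1ℚ; Positive; _+_; _*_; _-_; -_; _/_; 1/_; ∣_∣; _≤_; fromℚᵘ)
open import Data.Rational.Properties
open import Data.Rational.Solver using (module +-*-Solver)
open import Data.Rational.Unnormalised.Base as ℚᵘ using (mkℚᵘ)
import Data.Rational.Unnormalised.Properties as ℚᵘ
open import Data.Sum.Base using (inj₁; inj₂)
open import Function.Base using (_∘_)
open import Relation.Binary.PropositionalEquality
  using (_≡_; refl; sym; trans; cong; cong₂; subst; module ≡-Reasoning)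

open +-*-Solver
open ℕSolver.+-*-Solver using () renaming
  (solve to solveℕ; _:*_ to _⊗_; _:+_ to _⊕_; _:^_ to _⊛_; _:=_ to _⊜_; con to conℕ)

-- Rational arithmetic

fromℚᵘ-homo-+ : ∀ p q → fromℚᵘ (p ℚᵘ.+ q) ≡ fromℚᵘ p + fromℚᵘ q
fromℚᵘ-homo-+ p q = toℚᵘ-injective (ℚᵘ.≃-trans (toℚᵘ-fromℚᵘ (p ℚᵘ.+ q))
  (ℚᵘ.≃-sym (ℚᵘ.≃-trans (toℚᵘ-homo-+ (fromℚᵘ p) (fromℚᵘ q))
    (ℚᵘ.+-cong (toℚᵘ-fromℚᵘ p) (toℚᵘ-fromℚᵘ q)))))

fromℚᵘ-homo-* : ∀ p q → fromℚᵘ (p ℚᵘ.* q) ≡ fromℚᵘ p * fromℚᵘ q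
fromℚᵘ-homo-* p q = toℚᵘ-injective (ℚᵘ.≃-trans (toℚᵘ-fromℚᵘ (p ℚᵘ.* q))
  (ℚᵘ.≃-sym (ℚᵘ.≃-trans (toℚᵘ-homo-* (fromℚᵘ p) (fromℚᵘ q))
    (ℚᵘ.*-cong (toℚᵘ-fromℚᵘ p) (toℚᵘ-fromℚᵘ q)))))

/-mono-≤ : ∀ i j m n → i ℤ.* + suc n ℤ.≤ j ℤ.* + suc m → i / suc m ≤ j / suc n
/-mono-≤ i j m n cross = toℚᵘ-cancel-≤
  (ℚᵘ.≤-respˡ-≃ (ℚᵘ.≃-sym (toℚᵘ-fromℚᵘ (mkℚᵘ i m)))
    (ℚᵘ.≤-respʳ-≃ (ℚᵘ.≃-sym (toℚᵘ-fromℚᵘ (mkℚᵘ j n))) (ℚᵘ.*≤* cross)))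

fromℕ : ℕ → ℚ
fromℕ n = + n / 1

fromℕ-homo-+ : ∀ m n → fromℕ (m ℕ.+ n) ≡ fromℕ m + fromℕ n
fromℕ-homo-+ m n = trans
  (cong (_/ 1) (sym (cong₂ ℤ._+_ (ℤ.*-identityʳ (+ m)) (ℤ.*-identityʳ (+ n)))))
  (fromℚᵘ-homo-+ (mkℚᵘ (+ m) 0) (mkℚᵘ (+ n) 0))

fromℕ-suc : ∀ n → fromℕ (suc n) ≡ fromℕ n + 1ℚ
fromℕ-suc n = trans (fromℕ-homo-+ 1 n) (+-comm 1ℚ (fromℕ n))

fromℕ-homo-* : ∀ m n → fromℕ (m ℕ.* n) ≡ fromℕ m * fromℕ n
fromℕ-homo-* m n = trans (cong (_/ 1) (ℤ.pos-* m n))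
  (fromℚᵘ-homo-* (mkℚᵘ (+ m) 0) (mkℚᵘ (+ n) 0))

fromℕ-mono-≤ : ∀ {m n} → m ℕ.≤ n → fromℕ m ≤ fromℕ n
fromℕ-mono-≤ {m} {n} m≤n =
  /-mono-≤ (+ m) (+ n) 0 0 (ℤ.*-monoʳ-≤-nonNeg (+ 1) (ℤ.+≤+ m≤n))

fromℕ-nonNeg : ∀ n → ℚ.NonNegative (fromℕ n)
fromℕ-nonNeg n = normalize-nonNeg n 1

1/suc-anti-≤ : ∀ {m n} → m ℕ.≤ n → + 1 / suc n ≤ + 1 / suc m
1/suc-anti-≤ {m} {n} m≤n =
  /-mono-≤ (+ 1) (+ 1) n m (ℤ.*-monoˡ-≤-nonNeg (+ 1) (ℤ.+≤+ (s≤s m≤n)))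

1/suc-nonNeg : ∀ n → 0ℚ ≤ + 1 / suc n
1/suc-nonNeg n = nonNegative⁻¹ (+ 1 / suc n) {{normalize-nonNeg 1 (suc n)}}

-- What carries the bound 1/(n+1) through a halving: 2/(n+2) is still at least 1/(n+1).
1/suc≤double : ∀ n → + 1 / suc n ≤ (+ 1 / suc (suc n)) + (+ 1 / suc (suc n))
1/suc≤double n = subst (+ 1 / suc n ≤_)
  (fromℚᵘ-homo-+ (mkℚᵘ (+ 1) (suc n)) (mkℚᵘ (+ 1) (suc n)))
  (/-mono-≤ (+ 1) (+ (1 ℕ.* suc (suc n) ℕ.+ 1 ℕ.* suc (suc n)))
    n (suc n ℕ.+ suc n ℕ.* suc (suc n))
    -- After cross-multiplication the slack is 2(n+2)(n+1) - (n+2)(n+2) = n(n+2).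
    (ℤ.+≤+ (ℕ.≤-trans (ℕ.m≤m+n _ (n ℕ.* (2 ℕ.+ n))) (ℕ.≤-reflexive (eq n)))))
  where
  eq : ∀ n → 1 ℕ.* (suc (suc n) ℕ.* suc (suc n)) ℕ.+ n ℕ.* (2 ℕ.+ n)
           ≡ (1 ℕ.* suc (suc n) ℕ.+ 1 ℕ.* suc (suc n)) ℕ.* suc n
  eq = solveℕ 1 (λ n → let k = conℕ 2 ⊕ n in
    conℕ 1 ⊗ (k ⊗ k) ⊕ n ⊗ k ⊜ (conℕ 1 ⊗ k ⊕ conℕ 1 ⊗ k) ⊗ (conℕ 1 ⊕ n)) refl

-- A positive ε has the form (a+1)/(d+1), hence is at least 1/(d+1); the stored `d` is the witness.
archimedean : ∀ ε → Positive ε → ∃[ N ] (+ 1 / suc N ≤ ε)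
archimedean ε@(mkℚ (ℤ.+[1+ a ]) d _) _ = d , subst (+ 1 / suc d ≤_)
  (fromℚᵘ-toℚᵘ ε)
  (/-mono-≤ (+ 1) (ℤ.+[1+ a ]) d d
    (ℤ.*-monoʳ-≤-nonNeg (+ suc d) {+ 1} {ℤ.+[1+ a ]} (ℤ.+≤+ (s≤s z≤n))))

double-cancel-≤ : ∀ {p q} → p + p ≤ q + q → p ≤ q
double-cancel-≤ p+p≤q+q = ≮⇒≥ λ q<p →
  <-irrefl refl (<-≤-trans (+-mono-< q<p q<p) p+p≤q+q)

∣p-p∣≡0 : ∀ p → ∣ p - p ∣ ≡ 0ℚ
∣p-p∣≡0 p = cong ∣_∣ (+-inverseʳ p)

∣p-q∣≡∣q-p∣ : ∀ p q → ∣ p - q ∣ ≡ ∣ q - p ∣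
∣p-q∣≡∣q-p∣ p q = trans (sym (∣-p∣≡∣p∣ (p - q)))
  (cong ∣_∣ (solve 2 (λ p q → :- (p :- q) := q :- p) refl p q))

-- The difference `c - t` is the mean of `a - t` and `b - t` with weights `w` and 1, so the triangle
-- inequality applies. The mean is given multiplied out, the form in which continuants deliver it.
weightedMean-bound : ∀ w .{{_ : ℚ.NonNegative w}} {a b c t δ} →
  c * (w + 1ℚ) ≡ w * a + b → ∣ a - t ∣ ≤ δ → ∣ b - t ∣ ≤ δ → ∣ c - t ∣ ≤ δ
weightedMean-bound w {a} {b} {c} {t} {δ} mean a≤ b≤ =
  *-cancelʳ-≤-pos (w + 1ℚ) {{w+1-pos}} (begin
    ∣ c - t ∣ * (w + 1ℚ)         ≡⟨ cong (∣ c - t ∣ *_) (0≤p⇒∣p∣≡p 0≤w+1) ⟨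
    ∣ c - t ∣ * ∣ w + 1ℚ ∣       ≡⟨ ∣p*q∣≡∣p∣*∣q∣ (c - t) (w + 1ℚ) ⟨
    ∣ (c - t) * (w + 1ℚ) ∣       ≡⟨ cong ∣_∣ expand ⟩
    ∣ w * (a - t) + (b - t) ∣    ≤⟨ ∣p+q∣≤∣p∣+∣q∣ (w * (a - t)) (b - t) ⟩
    ∣ w * (a - t) ∣ + ∣ b - t ∣  ≡⟨ cong (_+ ∣ b - t ∣) (∣p*q∣≡∣p∣*∣q∣ w (a - t)) ⟩
    ∣ w ∣ * ∣ a - t ∣ + ∣ b - t ∣
      ≡⟨ cong (λ v → v * ∣ a - t ∣ + ∣ b - t ∣) (0≤p⇒∣p∣≡p (nonNegative⁻¹ w)) ⟩
    w * ∣ a - t ∣ + ∣ b - t ∣    ≤⟨ +-mono-≤ (*-monoˡ-≤-nonNeg w a≤) b≤ ⟩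
    w * δ + δ
      ≡⟨ solve 2 (λ w δ → w :* δ :+ δ := δ :* (w :+ con 1ℚ)) refl w δ ⟩
    δ * (w + 1ℚ)                 ∎)
  where
  open ≤-Reasoning

  w+1-pos : Positive (w + 1ℚ)
  w+1-pos = nonNeg+pos⇒pos w 1ℚ

  0≤w+1 : 0ℚ ≤ w + 1ℚ
  0≤w+1 = <⇒≤ (positive⁻¹ (w + 1ℚ) {{w+1-pos}})

  expand : (c - t) * (w + 1ℚ) ≡ w * (a - t) + (b - t)
  expand = trans
    (solve 3 (λ c t w → (c :- t) :* (w :+ con 1ℚ)
                      := c :* (w :+ con 1ℚ) :- t :* (w :+ con 1ℚ)) refl c t w)
    (trans (cong (_- t * (w + 1ℚ)) mean)
      (solve 4 (λ a b t w → w :* a :+ b :- t :* (w :+ con 1ℚ)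
                          := w :* (a :- t) :+ (b :- t)) refl a b t w))

-- Series whose terms halve

module HalvingSeries
  (f : ℕ → ℚ) (∣f₁∣≤1 : ∣ f 1 ∣ ≤ 1ℚ)
  (halves : ∀ n → ∣ f (2 ℕ.+ n) ∣ + ∣ f (2 ℕ.+ n) ∣ ≤ ∣ f (1 ℕ.+ n) ∣)
  where

  open ≤-Reasoning

  S : ℕ → ℚ
  S = partialSum f

  -- Much weaker than the geometric decay available, but exactly the modulus that `regular` asks
  -- for.
  term-bound : ∀ n → ∣ f (suc n) ∣ ≤ + 1 / suc n
  term-bound zero    = ∣f₁∣≤1
  term-bound (suc n) = double-cancel-≤
    (≤-trans (halves n) (≤-trans (term-bound n) (1/suc≤double n)))

  -- Halving gives ∣ f (2 + n) ∣ ≤ ∣ f (1 + n) ∣ - ∣ f (2 + n) ∣, which telescopes.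
  telescope : ∀ m k → ∣ S (suc (k ℕ.+ m)) - S (suc m) ∣ + ∣ f (suc (k ℕ.+ m)) ∣
                    ≤ ∣ f (suc m) ∣
  telescope m zero    = ≤-reflexive
    (trans (cong (_+ ∣ f (suc m) ∣) (∣p-p∣≡0 (S (suc m)))) (+-identityˡ _))
  telescope m (suc k) = begin
    ∣ S (2 ℕ.+ (k ℕ.+ m)) - S (suc m) ∣ + ∣g∣
      ≡⟨ cong (λ r → ∣ r ∣ + ∣g∣)
           (solve 3 (λ a b g → a :+ g :- b := a :- b :+ g) refl
             (S (suc (k ℕ.+ m))) (S (suc m)) g) ⟩
    ∣ d + g ∣ + ∣g∣                  ≤⟨ +-monoˡ-≤ ∣g∣ (∣p+q∣≤∣p∣+∣q∣ d g) ⟩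
    ∣ d ∣ + ∣g∣ + ∣g∣                ≡⟨ +-assoc ∣ d ∣ ∣g∣ ∣g∣ ⟩
    ∣ d ∣ + (∣g∣ + ∣g∣)              ≤⟨ +-monoʳ-≤ ∣ d ∣ (halves (k ℕ.+ m)) ⟩
    ∣ d ∣ + ∣ f (suc (k ℕ.+ m)) ∣    ≤⟨ telescope m k ⟩
    ∣ f (suc m) ∣                    ∎
    where
    d g ∣g∣ : ℚ
    d   = S (suc (k ℕ.+ m)) - S (suc m)
    g   = f (2 ℕ.+ (k ℕ.+ m))
    ∣g∣ = ∣ g ∣

  S-close : ∀ {m n} → m ℕ.≤ n → ∣ S (suc n) - S (suc m) ∣ ≤ + 1 / suc m
  S-close {m} {n} m≤n = subst (λ i → ∣ S (suc i) - S (suc m) ∣ ≤ + 1 / suc m)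
    (ℕ.m∸n+n≡m m≤n) (begin
      -- The zero makes room for the last term that `telescope` carries on its left side.
      ∣ d ∣             ≡⟨ +-identityʳ ∣ d ∣ ⟨
      ∣ d ∣ + 0ℚ        ≤⟨ +-monoʳ-≤ ∣ d ∣ (0≤∣p∣ _) ⟩
      ∣ d ∣ + ∣ f (suc (n ∸ m ℕ.+ m)) ∣  ≤⟨ telescope m (n ∸ m) ⟩
      ∣ f (suc m) ∣     ≤⟨ term-bound m ⟩
      + 1 / suc m       ∎)
    where
    d : ℚ
    d = S (suc (n ∸ m ℕ.+ m)) - S (suc m)

  S-regular : ∀ m n → ∣ S (suc m) - S (suc n) ∣ ≤ (+ 1 / suc m) + (+ 1 / suc n)
  S-regular m n with ℕ.≤-total m n
  ... | inj₁ m≤n = begin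
    ∣ S (suc m) - S (suc n) ∣      ≡⟨ ∣p-q∣≡∣q-p∣ (S (suc m)) (S (suc n)) ⟩
    ∣ S (suc n) - S (suc m) ∣      ≤⟨ S-close m≤n ⟩
    + 1 / suc m                    ≡⟨ +-identityʳ _ ⟨
    (+ 1 / suc m) + 0ℚ             ≤⟨ +-monoʳ-≤ (+ 1 / suc m) (1/suc-nonNeg n) ⟩
    (+ 1 / suc m) + (+ 1 / suc n)  ∎
  ... | inj₂ n≤m = begin
    ∣ S (suc m) - S (suc n) ∣      ≤⟨ S-close n≤m ⟩
    + 1 / suc n                    ≡⟨ +-identityˡ _ ⟨
    0ℚ + (+ 1 / suc n)             ≤⟨ +-monoˡ-≤ (+ 1 / suc n) (1/suc-nonNeg m) ⟩
    (+ 1 / suc m) + (+ 1 / suc n)  ∎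

  -- The shift by one discards the empty sum `S 0`: the tail after `S (suc n)` is at most
  -- `∣ f (suc n) ∣`, hence at most 1/(n+1).
  limit : ℝ
  limit = record { approx = S ∘ suc ; regular = S-regular }

  -- The offset `k` drops initial values of `q` that have no estimate; past `k + N` the error
  -- 1/(n-k+1) is below ε.
  ⟶limit : ∀ (q : ℕ → ℚ) k →
    (∀ n → ∣ q (k ℕ.+ n) - limit ∣≤ (+ 1 / suc n)) → q ⟶ limit
  ⟶limit q k close ε ε⁺ with N , 1/N≤ε ← archimedean ε ε⁺ =
    k ℕ.+ N , λ n n≥k+N m →
      let k≤n = ℕ.≤-trans (ℕ.m≤m+n k N) n≥k+N
          N≤n∸k = subst (ℕ._≤ n ∸ k) (ℕ.m+n∸m≡n k N) (ℕ.∸-monoˡ-≤ k n≥k+N)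
      in subst (λ i → ∣ q i - S (suc m) ∣ ≤ ε + (+ 1 / suc m)) (ℕ.m+[n∸m]≡n k≤n)
           (≤-trans (close (n ∸ k) m)
             (+-monoˡ-≤ (+ 1 / suc m) (≤-trans (1/suc-anti-≤ N≤n∸k) 1/N≤ε)))

  sum-limit : IsSeriesSum f limit
  -- With offset 1, `S (1 + n)` is the n-th approximation itself, so regularity is the required
  -- estimate.
  sum-limit = ⟶limit S 1 S-regular

-- Continuants

-- Euler's continuant of the first n entries of `c`. It is expanded at the front because
-- `convergent` also recurses on the tail.
continuant : (ℕ → ℕ) → ℕ → ℚ
continuant c 0             = 1ℚ
continuant c 1             = fromℕ (c 0)
continuant c (suc (suc n)) =
  fromℕ (c 0) * continuant (c ∘ suc) (suc n) + continuant (c ∘ suc ∘ suc) n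

-- Expansion at the back, needed for induction along the sequence of convergents. Expansions at the
-- two ends commute, which gives a two-step induction.
continuant-last : ∀ c n → continuant c (2 ℕ.+ n)
  ≡ fromℕ (c (suc n)) * continuant c (suc n) + continuant c n
continuant-last c 0 = cong (_+ 1ℚ) (*-comm (fromℕ (c 0)) (fromℕ (c 1)))
continuant-last c 1 =
  solve 3 (λ a b d → a :* (b :* d :+ con 1ℚ) :+ d := d :* (a :* b :+ con 1ℚ) :+ a)
    refl (fromℕ (c 0)) (fromℕ (c 1)) (fromℕ (c 2))
continuant-last c (suc (suc n)) = trans
  (cong₂ (λ u v → fromℕ (c 0) * u + v)
    (continuant-last (c ∘ suc) (suc n)) (continuant-last (c ∘ suc ∘ suc) n))
  (solve 6 (λ a l p q r s →
      a :* (l :* p :+ q) :+ (l :* r :+ s) := l :* (a :* p :+ r) :+ (a :* q :+ s)) refl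
    (fromℕ (c 0)) (fromℕ (c (3 ℕ.+ n)))
    (continuant (c ∘ suc) (2 ℕ.+ n)) (continuant (c ∘ suc) (suc n))
    (continuant (c ∘ suc ∘ suc) (suc n)) (continuant (c ∘ suc ∘ suc) n))

-- The classical quotient K(c₀,...,cₙ) / K(c₁,...,cₙ), multiplied out to avoid dividing by a
-- continuant.
convergent-continuant : ∀ c (c⁺ : ∀ k → NonZero (c (suc k))) n →
  convergent c c⁺ n * continuant (c ∘ suc) n ≡ continuant c (suc n)
convergent-continuant c c⁺ zero    = *-identityʳ _
convergent-continuant c c⁺ (suc n) = begin
  (a + 1/ t) * K             ≡⟨ *-distribʳ-+ K a (1/ t) ⟩
  a * K + 1/ t * K           ≡⟨ cong (λ r → a * K + 1/ t * r) tail-eq ⟨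
  a * K + 1/ t * (t * K′)    ≡⟨ cong (_+_ (a * K)) (*-assoc (1/ t) t K′) ⟨
  a * K + 1/ t * t * K′      ≡⟨ cong (λ r → a * K + r * K′) (*-inverseˡ t) ⟩
  a * K + 1ℚ * K′            ≡⟨ cong (_+_ (a * K)) (*-identityˡ K′) ⟩
  a * K + K′                 ∎
  where
  open ≡-Reasoning
  a K K′ t : ℚ
  a  = fromℕ (c 0)
  K  = continuant (c ∘ suc) (suc n)
  K′ = continuant (c ∘ suc ∘ suc) n
  t  = convergent (c ∘ suc) (c⁺ ∘ suc) n

  instance
    t≢0 : ℚ.NonZero t
    t≢0 = pos⇒nonZero t {{convergent-pos (c ∘ suc) (c⁺ ∘ suc) (c⁺ 0) n}}

  tail-eq : t * K′ ≡ K
  tail-eq = convergent-continuant (c ∘ suc) (c⁺ ∘ suc) n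

-- The sequence

-- Relates consecutive terms of the series. The factorisation of `z` is a hypothesis because that of
-- `x (2 + n)` is only a proved equation.
-1*s/xy*y≡-s/x : ∀ s x y z .{{_ : NonZero x}} .{{_ : NonZero z}} →
  z ≡ x ℕ.* y → ((-1ℤ ℤ.* s) / z) * fromℕ y ≡ - (s / x)
-1*s/xy*y≡-s/x s (suc x) y (suc z) z≡xy = begin
  fromℚᵘ (mkℚᵘ (-1ℤ ℤ.* s) z) * fromℚᵘ (mkℚᵘ (+ y) 0)
    ≡⟨ fromℚᵘ-homo-* (mkℚᵘ (-1ℤ ℤ.* s) z) (mkℚᵘ (+ y) 0) ⟨
  fromℚᵘ (mkℚᵘ (-1ℤ ℤ.* s) z ℚᵘ.* mkℚᵘ (+ y) 0)
    ≡⟨ fromℚᵘ-cong {mkℚᵘ (-1ℤ ℤ.* s) z ℚᵘ.* mkℚᵘ (+ y) 0} {ℚᵘ.- mkℚᵘ s x}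
         (ℚᵘ.*≡* cross) ⟩
  fromℚᵘ (ℚᵘ.- mkℚᵘ s x)
    ≡⟨ toℚᵘ-injective (ℚᵘ.≃-trans (toℚᵘ-fromℚᵘ (ℚᵘ.- mkℚᵘ s x))
         (ℚᵘ.≃-sym (ℚᵘ.≃-trans (toℚᵘ-homo‿- (s / suc x))
           (ℚᵘ.-‿cong (toℚᵘ-fromℚᵘ (mkℚᵘ s x)))))) ⟩
  - (s / suc x) ∎
  where
  open ≡-Reasoning

  cross : (-1ℤ ℤ.* s ℤ.* + y) ℤ.* + suc x ≡ (ℤ.- s) ℤ.* + (suc z ℕ.* 1)
  cross = begin
    (-1ℤ ℤ.* s ℤ.* + y) ℤ.* + suc x
      ≡⟨ cong (λ r → r ℤ.* + y ℤ.* + suc x) (ℤ.-1*i≡-i s) ⟩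
    (ℤ.- s) ℤ.* + y ℤ.* + suc x      ≡⟨ ℤ.*-assoc (ℤ.- s) (+ y) (+ suc x) ⟩
    (ℤ.- s) ℤ.* (+ y ℤ.* + suc x)    ≡⟨ cong ((ℤ.- s) ℤ.*_) (ℤ.pos-* y (suc x)) ⟨
    (ℤ.- s) ℤ.* + (y ℕ.* suc x)
      ≡⟨ cong (λ r → (ℤ.- s) ℤ.* + r)
           (trans (ℕ.*-comm y (suc x)) (trans (sym z≡xy) (sym (ℕ.*-identityʳ (suc z))))) ⟩
    (ℤ.- s) ℤ.* + (suc z ℕ.* 1)      ∎

module _ {x : ℕ → ℕ} (s : IsSequence x) where

  open IsSequence s

  private instance
    x⁺ : ∀ {n} → NonZero (x n)
    x⁺ {n} = positive n

  y : ℕ → ℕ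
  y zero    = 1
  y (suc n) = y n ℕ.* suc (x n)

  -- Substituting the induction hypothesis into the recurrence leaves a common factor `x n`, which
  -- is positive and cancels.
  x-suc : ∀ n → x (suc n) ≡ x n ℕ.* y n
  x-suc zero    = trans x₁≡1 (sym (trans (ℕ.*-identityʳ (x 0)) x₀≡1))
  x-suc (suc n) = ℕ.*-cancelʳ-≡ _ _ (x n) (begin
    x (2 ℕ.+ n) ℕ.* x n                        ≡⟨ recurrence n ⟩
    x (suc n) ℕ.^ 2 ℕ.* (x n ℕ.+ 1)
      ≡⟨ cong (λ r → r ℕ.^ 2 ℕ.* (x n ℕ.+ 1)) (x-suc n) ⟩
    (x n ℕ.* y n) ℕ.^ 2 ℕ.* (x n ℕ.+ 1)
      ≡⟨ solveℕ 2 (λ a b → (a ⊗ b) ⊛ 2 ⊗ (a ⊕ conℕ 1)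
                         ⊜ a ⊗ b ⊗ (b ⊗ (conℕ 1 ⊕ a)) ⊗ a) refl (x n) (y n) ⟩
    x n ℕ.* y n ℕ.* y (suc n) ℕ.* x n
      ≡⟨ cong (λ r → r ℕ.* y (suc n) ℕ.* x n) (x-suc n) ⟨
    x (suc n) ℕ.* y (suc n) ℕ.* x n            ∎)
    where
    open ≡-Reasoning

  1≤y : ∀ n → 1 ℕ.≤ y n
  1≤y zero    = ℕ.≤-refl
  1≤y (suc n) = ℕ.*-mono-≤ (1≤y n) (s≤s z≤n)

  2≤y-suc : ∀ n → 2 ℕ.≤ y (suc n)
  2≤y-suc n = ℕ.*-mono-≤ (1≤y n) (s≤s (ℕ.>-nonZero⁻¹ (x n)))

  term : ℕ → ℚ
  term n = ((-1ℤ ^ (n ∸ 1)) / x n) {{positive n}}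

  term-suc : ∀ n → term (2 ℕ.+ n) * fromℕ (y (suc n)) ≡ - term (suc n)
  term-suc n =
    -1*s/xy*y≡-s/x (-1ℤ ^ n) (x (suc n)) (y (suc n)) (x (2 ℕ.+ n)) (x-suc (suc n))

  term₁ : term 1 ≡ 1ℚ
  term₁ = /-cong {p₁ = + 1} {q₁ = x 1} {p₂ = + 1} {q₂ = 1} refl x₁≡1

  term-halves : ∀ n → ∣ term (2 ℕ.+ n) ∣ + ∣ term (2 ℕ.+ n) ∣ ≤ ∣ term (suc n) ∣
  term-halves n = begin
    ∣ t ∣ + ∣ t ∣                ≡⟨ solve 1 (λ r → r :+ r := r :* con (fromℕ 2)) refl ∣ t ∣ ⟩
    ∣ t ∣ * fromℕ 2
      ≤⟨ *-monoˡ-≤-nonNeg ∣ t ∣ {{∣-∣-nonNeg t}} (fromℕ-mono-≤ (2≤y-suc n)) ⟩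
    ∣ t ∣ * fromℕ (y (suc n))
      ≡⟨ cong (∣ t ∣ *_) (0≤p⇒∣p∣≡p (nonNegative⁻¹ _ {{fromℕ-nonNeg (y (suc n))}})) ⟨
    ∣ t ∣ * ∣ fromℕ (y (suc n)) ∣  ≡⟨ ∣p*q∣≡∣p∣*∣q∣ t (fromℕ (y (suc n))) ⟨
    ∣ t * fromℕ (y (suc n)) ∣    ≡⟨ cong ∣_∣ (term-suc n) ⟩
    ∣ - term (suc n) ∣           ≡⟨ ∣-p∣≡∣p∣ (term (suc n)) ⟩
    ∣ term (suc n) ∣             ∎
    where
    open ≤-Reasoning
    t : ℚ
    t = term (2 ℕ.+ n)

  open HalvingSeries term (≤-reflexive (cong ∣_∣ term₁)) term-halves public

  -- Closed forms for the numerators and denominators of the convergents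

  Y X : ℕ → ℚ
  Y n = fromℕ (y n)
  X n = fromℕ (x n)

  Y-suc : ∀ n → Y (suc n) ≡ Y n * (X n + 1ℚ)
  Y-suc n = trans (fromℕ-homo-* (y n) (suc (x n))) (cong (Y n *_) (fromℕ-suc (x n)))

  X-suc : ∀ n → X (suc n) ≡ X n * Y n
  X-suc n = trans (cong fromℕ (x-suc n)) (fromℕ-homo-* (x n) (y n))

  X₁ : X 1 ≡ 1ℚ
  X₁ = cong fromℕ x₁≡1

  Y₁ : Y 1 ≡ fromℕ 2
  Y₁ = cong (λ r → fromℕ (1 ℕ.* suc r)) x₀≡1

  Y₂ : Y 2 ≡ fromℕ 4
  Y₂ = trans (Y-suc 1) (cong₂ (λ u v → u * (v + 1ℚ)) Y₁ X₁)

  private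
    c : ℕ → ℕ
    c = quotients x

  denominator : ∀ n → continuant (c ∘ suc) (3 ℕ.+ n) ≡ Y (suc n) + 1ℚ
  denominator zero       = sym (cong (_+ 1ℚ) Y₁)
  denominator (suc zero) = begin
    continuant (c ∘ suc) 4  ≡⟨ continuant-last (c ∘ suc) 2 ⟩
    X 1 * fromℕ 3 + fromℕ 2  ≡⟨ cong (λ r → r * fromℕ 3 + fromℕ 2) X₁ ⟩
    fromℕ 4 + 1ℚ            ≡⟨ cong (_+ 1ℚ) Y₂ ⟨
    Y 2 + 1ℚ                ∎
    where open ≡-Reasoning
  denominator (suc (suc n)) = begin
    continuant (c ∘ suc) (5 ℕ.+ n)  ≡⟨ continuant-last (c ∘ suc) (3 ℕ.+ n) ⟩
    X (2 ℕ.+ n) * continuant (c ∘ suc) (4 ℕ.+ n) + continuant (c ∘ suc) (3 ℕ.+ n)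
      ≡⟨ cong₂ (λ u v → X (2 ℕ.+ n) * u + v) (denominator (suc n)) (denominator n) ⟩
    X (2 ℕ.+ n) * (Y (2 ℕ.+ n) + 1ℚ) + (Y (suc n) + 1ℚ)
      -- The key relation is yₙ₊₂ = xₙ₊₂ + yₙ₊₁, both sides being yₙ₊₁ (xₙ₊₁ + 1). Expressing
      -- everything in xₙ₊₁ and yₙ₊₁ leaves a polynomial identity.
      ≡⟨ identity (X (suc n)) (Y (suc n)) (X-suc (suc n)) (Y-suc (suc n)) (Y-suc (2 ℕ.+ n)) ⟩
    Y (3 ℕ.+ n) + 1ℚ ∎
    where
    open ≡-Reasoning
    identity : ∀ a b {a′ b′ b″} → a′ ≡ a * b → b′ ≡ b * (a + 1ℚ) → b″ ≡ b′ * (a′ + 1ℚ) →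
      a′ * (b′ + 1ℚ) + (b + 1ℚ) ≡ b″ + 1ℚ
    identity a b refl refl refl = solve 2 (λ a b →
      let a′ = a :* b ; b′ = b :* (a :+ con 1ℚ) in
      a′ :* (b′ :+ con 1ℚ) :+ (b :+ con 1ℚ) := b′ :* (a′ :+ con 1ℚ) :+ con 1ℚ) refl a b

  S₁ : S 1 ≡ 1ℚ
  S₁ = trans (+-identityˡ (term 1)) term₁

  numerator : ∀ n → continuant c (4 ℕ.+ n) ≡ Y (suc n) * S (suc n) + S n
  numerator zero       = sym (cong₂ (λ u v → u * v + 0ℚ) Y₁ S₁)
  numerator (suc zero) = begin
    continuant c 5               ≡⟨ continuant-last c 3 ⟩
    X 1 * fromℕ 2 + 1ℚ           ≡⟨ cong (λ r → r * fromℕ 2 + 1ℚ) X₁ ⟩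
    -- Writing 3 as 5 + 2(-1) brings in `term 2` through `t₂*2≡-1`.
    fromℕ 3                      ≡⟨ cong (λ r → fromℕ 5 + fromℕ 2 * r) t₂*2≡-1 ⟨
    fromℕ 5 + fromℕ 2 * (term 2 * fromℕ 2)
      ≡⟨ solve 1 (λ t → con (fromℕ 5) :+ con (fromℕ 2) :* (t :* con (fromℕ 2))
                      := con (fromℕ 4) :* (con 1ℚ :+ t) :+ con 1ℚ) refl (term 2) ⟩
    fromℕ 4 * (1ℚ + term 2) + 1ℚ
      ≡⟨ cong₂ (λ u v → u * (v + term 2) + v) Y₂ S₁ ⟨
    Y 2 * S 2 + S 1              ∎
    where
    open ≡-Reasoning

    t₂*2≡-1 : term 2 * fromℕ 2 ≡ - 1ℚ
    t₂*2≡-1 = trans (cong (term 2 *_) (sym Y₁)) (trans (term-suc 0) (cong -_ term₁))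
  numerator (suc (suc n)) = begin
    continuant c (6 ℕ.+ n)  ≡⟨ continuant-last c (4 ℕ.+ n) ⟩
    X (2 ℕ.+ n) * continuant c (5 ℕ.+ n) + continuant c (4 ℕ.+ n)
      ≡⟨ cong₂ (λ u v → X (2 ℕ.+ n) * u + v) (numerator (suc n)) (numerator n) ⟩
    X (2 ℕ.+ n) * (Y (2 ℕ.+ n) * S (2 ℕ.+ n) + S (suc n)) + (Y (suc n) * S (suc n) + S n)
      ≡⟨ identity (X (suc n)) (Y (suc n)) (S n) (term (3 ℕ.+ n))
           (X-suc (suc n)) (Y-suc (suc n)) (Y-suc (2 ℕ.+ n))
           (previous-term (suc n)) (previous-term n) ⟩
    Y (3 ℕ.+ n) * S (3 ℕ.+ n) + S (2 ℕ.+ n) ∎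
    where
    open ≡-Reasoning

    -- Solving for the earlier term avoids division: the last three terms become polynomials in the
    -- newest one.
    previous-term : ∀ n → term (suc n) ≡ - (term (2 ℕ.+ n) * Y (suc n))
    previous-term n = trans (solve 1 (λ t → t := :- (:- t)) refl (term (suc n)))
      (cong -_ (sym (term-suc n)))

    -- Here σ is Sₙ and t″, t′, t are the three terms after it. By b′ = a′ + b the difference of the
    -- two sides collapses to b t′ + t″, which vanishes.
    identity : ∀ a b σ t {a′ b′ b″ t′ t″} →
      a′ ≡ a * b → b′ ≡ b * (a + 1ℚ) → b″ ≡ b′ * (a′ + 1ℚ) →
      t′ ≡ - (t * b′) → t″ ≡ - (t′ * b) →
      a′ * (b′ * (σ + t″ + t′) + (σ + t″)) + (b * (σ + t″) + σ)
        ≡ b″ * (σ + t″ + t′ + t) + (σ + t″ + t′)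
    identity a b σ t refl refl refl refl refl = solve 4 (λ a b σ t →
      let a′ = a :* b
          b′ = b :* (a :+ con 1ℚ)
          b″ = b′ :* (a′ :+ con 1ℚ)
          t′ = :- (t :* b′)
          t″ = :- (t′ :* b)
      in a′ :* (b′ :* (σ :+ t″ :+ t′) :+ (σ :+ t″)) :+ (b :* (σ :+ t″) :+ σ)
           := b″ :* (σ :+ t″ :+ t′ :+ t) :+ (σ :+ t″ :+ t′)) refl a b σ t

  -- Convergence of the continued fraction

  convergent-mean : ∀ n →
    convergent c (quotients⁺ s) (3 ℕ.+ n) * (Y (suc n) + 1ℚ) ≡ Y (suc n) * S (suc n) + S n
  convergent-mean n = begin
    C * (Y (suc n) + 1ℚ)                   ≡⟨ cong (C *_) (denominator n) ⟨
    C * continuant (c ∘ suc) (3 ℕ.+ n)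
      ≡⟨ convergent-continuant c (quotients⁺ s) (3 ℕ.+ n) ⟩
    continuant c (4 ℕ.+ n)                 ≡⟨ numerator n ⟩
    Y (suc n) * S (suc n) + S n            ∎
    where
    open ≡-Reasoning
    C : ℚ
    C = convergent c (quotients⁺ s) (3 ℕ.+ n)

  -- Starting at index 4 makes this a mean of `S (2 + n)` and `S (1 + n)`, the approximations n+1
  -- and n of `limit`; index 3 would involve `S 0`, which is not among them.
  convergent-close : ∀ n →
    ∣ convergent c (quotients⁺ s) (4 ℕ.+ n) - limit ∣≤ (+ 1 / suc n)
  convergent-close n m =
    weightedMean-bound (Y (2 ℕ.+ n)) {{fromℕ-nonNeg (y (2 ℕ.+ n))}}
      {c = convergent c (quotients⁺ s) (4 ℕ.+ n)}
      (convergent-mean (suc n))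
      (≤-trans (S-regular (suc n) m)
        (+-monoˡ-≤ (+ 1 / suc m) (1/suc-anti-≤ (ℕ.n≤1+n n))))
      (S-regular n m)

  fraction-limit : IsContinuedFraction c (quotients⁺ s) limit
  fraction-limit = ⟶limit (convergent c (quotients⁺ s)) 4 convergent-close

mainTheorem7 : (x : ℕ → ℕ) (s : IsSequence x) →
    ∃[ α ] (IsContinuedFraction (quotients x) (quotients⁺ s) α
    × IsSeriesSum (λ n → ((-1ℤ ^ (n ∸ 1)) / x n) {{IsSequence.positive s n}}) α)
mainTheorem7 x s = limit s , fraction-limit s , sum-limit s
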